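{- Let $w\in S_n$, let $C^N(w)$ be the nested climbing chain of $w$, and let $\xi(w)=(C^N(w),M(C^N(w)))$. Then $$\overline{\mathrm{wt}}(\xi(w))=\overline{\mathrm{rajcode}}(w).$$
   Context: Conventions. Permutations are in one-line notation; $t_{ij}$ is the transposition of $i,j$, and $wt_{ij}$ is $w$ with the values in positions $i$ and $j$ exchanged. $w_0\in S_n$ is the longest permutation, $w_0(k)=n+1-k$. The Bruhat order is the transitive closure of $w\le wt_{ij}$ for $i<j$ with $w(i)<w(j)$; $\lessdot$ denotes its cover relation. $[n]=\{1,\ldots,n\}$. Climbing chains. A climbing chain of $w\in S_n$ is a sequence $C=(C_1,\ldots,C_m)$ of pairs (links) $C_p=(i_p,j_p)$ with $i_p<j_p$, $i_1\le\cdots\le i_m$, $wt_{i_1j_1}\cdots t_{i_mj_m}=w_0$, and $wt_{i_1j_1}\cdots t_{i_{p-1}j_{p-1}}\lessdot wt_{i_1j_1}\cdots t_{i_pj_p}$ for each $p\in[m]$. (The only climbing chain of $w_0$ is empty. The links of a chain are distinct, so $C$ is also regarded as a set.) The set of minimal markings is $M(C)=\{C_p\mid i_{p-1}<i_p,\text{ or } i_{p-1}=i_p\text{ and }j_{p-1}<j_p\}$ with $i_0=0$. For $M(C)\subseteq U\subseteq C$, the dual weight $\overline{\mathrm{wt}}(C,U)\in\mathbb{Z}^n$ has $k$th entry the number of links of the form $(k,\star)$ in $U$. Increasing subsequences. An increasing subsequence of $w$ starting from position $q$ is $\alpha=(\alpha_1,\ldots,\alpha_r)$ with $q=\alpha_1<\cdots<\alpha_r\le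 n$ and $w(\alpha_1)<\cdots<w(\alpha_r)$; $\mathrm{LIS}(w,q)$ is the set of those of maximal length $r$. $\overline{\mathrm{rajcode}}(w)\in\mathbb{Z}^n$ has $i$th entry the length of any element of $\mathrm{LIS}(w,i)$ minus one. Nested chain. For $w\ne w_0$, let $q=\min\{j\mid w(j)\ne n+1-j\}$, let $\alpha$ be the lexicographically last element of $\mathrm{LIS}(w,q)$, and set $\mathrm{nested}(w)=(\alpha_1,\alpha_2)$. $C^N(w_0)$ is empty; for $w\neq w_0$ with $\mathrm{nested}(w)=(a,b)$, $C^N(w)$ is obtained by prepending $(a,b)$ to $C^N(wt_{ab})$. It is a climbing chain of $w$. -}

module Defs where

import Algebra.Properties.CommutativeMonoid.Sum
open import Data.Bool.Base using (if_then_else_)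
open import Data.Empty using (⊥-elim)
open import Data.Fin.Base using (Fin; zero; suc; toℕ; fromℕ<; opposite; _<_; _≤_; _>_)
open import Data.Fin.Induction using (>-wellFounded)
open import Data.Fin.Permutation
  using (Permutation′; _⟨$⟩ʳ_; _⟨$⟩ˡ_; _≈_; _∘ₚ_; transpose; reverse; inverseˡ; inverseʳ)
open import Data.Fin.Properties as Fin using (_≟_; _<?_)
open import Data.Integer.Base using (ℤ; +_; _-_; 1ℤ)
open import Data.List.Base using (List; []; _∷_; head; length; filter)
open import Data.List.Relation.Binary.Lex.Strict using (Lex-≤; base; this; next)
open import Data.List.Relation.Binary.Sublist.Propositional as Sublist using (_⊆_; []; _∷_; _∷ʳ_)
open import Data.List.Relation.Unary.Linked using (Linked; []; [-]; _∷_)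
open import Data.Maybe.Base using (just)
open import Data.Nat.Base as ℕ using (ℕ; zero; suc; z≤n; s≤s; _+_; _*_)
import Data.Nat.Induction as ℕ
import Data.Nat.Properties as ℕ
open import Data.Nat.Tactic.RingSolver using (solve-∀)
open import Data.Product.Base using (∃; ∃₂; _×_; _,_; proj₁; proj₂)
open import Data.Sum.Base using (_⊎_; inj₁; inj₂; [_,_]′)
open import Data.Vec.Base using (Vec; tabulate)
open import Function.Base using (_∘_; _on_)
open import Induction.WellFounded using (Acc; acc)
open import Relation.Binary.Construct.Closure.Transitive using (TransClosure; [_]; _∷_)
open import Relation.Binary.Definitions using (tri<; tri≈; tri>)
open import Relation.Binary.PropositionalEquality
  using (_≡_; _≢_; refl; sym; trans; cong; cong₂; subst; subst₂)
open import Relation.Nullary using (¬_; Dec; yes; no; does)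
open import Relation.Nullary.Decidable using (_×-dec_; _⊎-dec_; dec-true; dec-false)
open import Relation.Unary using (Decidable)

private
  module Sum = Algebra.Properties.CommutativeMonoid.Sum ℕ.+-0-commutativeMonoid
open Sum using (sum)

private
  variable
    n : ℕ

------------------------------------------------------------------------
-- Permutations and Bruhat order

-- S_n acts on Fin n, so positions and values run over 0, …, n-1.

Perm : ℕ → Set
Perm = Permutation′

w₀ : Perm n
w₀ = reverse

-- _∘ₚ_ applies its left argument first, so this exchanges the values of
-- w in positions i and j.

infixl 10 _·⟨_,_⟩

_·⟨_,_⟩ : Perm n → Fin n → Fin n → Perm n
w ·⟨ i , j ⟩ = transpose i j ∘ₚ w

infix 4 _⟶_ _<ᴮ_ _⋖_

_⟶_ : Perm n → Perm n → Set
u ⟶ v = ∃₂ λ i j → i < j × u ⟨$⟩ʳ i < u ⟨$⟩ʳ j × v ≈ u ·⟨ i , j ⟩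

-- The strict part of the Bruhat order.

_<ᴮ_ : Perm n → Perm n → Set
_<ᴮ_ = TransClosure _⟶_

_⋖_ : Perm n → Perm n → Set
u ⋖ v = u <ᴮ v × ¬ ∃ λ z → u <ᴮ z × z <ᴮ v

------------------------------------------------------------------------
-- Climbing chains and their weights

Link : ℕ → Set
Link n = Fin n × Fin n

data ClimbsTo-w₀ {n} : Perm n → List (Link n) → Set where
  []  : ∀ {w} → w ≈ w₀ → ClimbsTo-w₀ w []
  _∷_ : ∀ {w i j C} → i < j × w ⋖ w ·⟨ i , j ⟩ →
        ClimbsTo-w₀ (w ·⟨ i , j ⟩) C → ClimbsTo-w₀ w ((i , j) ∷ C)

record ClimbingChain (w : Perm n) : Set where
  field
    links    : List (Link n)
    climbing : ClimbsTo-w₀ w links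
    monotone : Linked (_≤_ on proj₁) links

-- MinimallyMarked l l′: the link l′, coming right after l, is a minimal marking.

MinimallyMarked : Link n → Link n → Set
MinimallyMarked (i , j) (i′ , j′) = i < i′ ⊎ (i ≡ i′ × j < j′)

minimallyMarked? : (l l′ : Link n) → Dec (MinimallyMarked l l′)
minimallyMarked? (i , j) (i′ , j′) = (i <? i′) ⊎-dec ((i ≟ i′) ×-dec (j <? j′))

markedAfter : Link n → List (Link n) → List (Link n)
markedAfter _ []       = []
markedAfter l (l′ ∷ C) with minimallyMarked? l l′
... | yes _ = l′ ∷ markedAfter l′ C
... | no  _ = markedAfter l′ C

-- The first link is always marked, because of the convention i₀ = 0 < i₁
-- for positions numbered from 1.

minimalMarkings : List (Link n) → List (Link n)
minimalMarkings []      = []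
minimalMarkings (l ∷ C) = l ∷ markedAfter l C

-- As the links of a climbing chain are distinct, its subsets are the
-- same thing as its sublists.

record MarkedChain (w : Perm n) : Set where
  field
    chain      : ClimbingChain w
    marked     : List (Link n)
    minimal⊆   : minimalMarkings (ClimbingChain.links chain) ⊆ marked
    marked⊆    : marked ⊆ ClimbingChain.links chain

dualWt : {w : Perm n} → MarkedChain w → Vec ℤ n
dualWt ξ = tabulate λ k → + length (filter (λ l → proj₁ l ≟ k) (MarkedChain.marked ξ))

markedAfter-⊆ : (l : Link n) (C : List (Link n)) → markedAfter l C ⊆ C
markedAfter-⊆ _ []       = []
markedAfter-⊆ l (l′ ∷ C) with minimallyMarked? l l′
... | yes _ = refl ∷ markedAfter-⊆ l′ C
... | no  _ = l′ ∷ʳ markedAfter-⊆ l′ C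

minimalMarkings-⊆ : (C : List (Link n)) → minimalMarkings C ⊆ C
minimalMarkings-⊆ []      = []
minimalMarkings-⊆ (l ∷ C) = refl ∷ markedAfter-⊆ l C

------------------------------------------------------------------------
-- Longest increasing subsequences

record IncreasingFrom (w : Perm n) (q : Fin n) (α : List (Fin n)) : Set where
  constructor increasing
  field
    starts    : head α ≡ just q
    positions : Linked _<_ α
    values    : Linked (_<_ on (w ⟨$⟩ʳ_)) α

LIS : Perm n → Fin n → List (Fin n) → Set
LIS w q α = IncreasingFrom w q α × (∀ β → IncreasingFrom w q β → length β ℕ.≤ length α)

LIS-length : (w : Perm n) (q : Fin n) {α β : List (Fin n)} →
             LIS w q α → LIS w q β → length α ≡ length β
LIS-length w q (α↗ , α-max) (β↗ , β-max) = ℕ.≤-antisym (β-max _ α↗) (α-max _ β↗)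

infix 4 _≤ₗₑₓ_

_≤ₗₑₓ_ : List (Fin n) → List (Fin n) → Set
_≤ₗₑₓ_ = Lex-≤ _≡_ _<_

LexLastLIS : Perm n → Fin n → List (Fin n) → Set
LexLastLIS w q α = LIS w q α × (∀ β → LIS w q β → β ≤ₗₑₓ α)

-- Among the indices satisfying P, the last one maximising k.

lastArgmax : ∀ {m} {P : Fin m → Set} → Decidable P → (k : Fin m → ℕ) →
             (∀ i → ¬ P i) ⊎
             (∃ λ r → P r × ∀ s → P s → k s ℕ.< k r ⊎ (k s ≡ k r × s ≤ r))
lastArgmax {zero}  P? k = inj₁ λ ()
lastArgmax {suc m} P? k with lastArgmax (P? ∘ suc) (k ∘ suc) | P? zero
... | inj₁ none | no ¬P₀ = inj₁ λ { zero → ¬P₀ ; (suc i) → none i }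
... | inj₁ none | yes P₀ = inj₂ (zero , P₀ , λ
  { zero    _  → inj₂ (refl , z≤n)
  ; (suc s) Ps → ⊥-elim (none s Ps) })
... | inj₂ (r , Pr , best) | no ¬P₀ = inj₂ (suc r , Pr , λ
  { zero    P₀ → ⊥-elim (¬P₀ P₀)
  ; (suc s) Ps → [ inj₁ , (λ (e , s≤r) → inj₂ (e , s≤s s≤r)) ]′ (best s Ps) })
... | inj₂ (r , Pr , best) | yes P₀ with ℕ.<-cmp (k zero) (k (suc r))
...   | tri< k₀<kr _ _ = inj₂ (suc r , Pr , λ
  { zero    _  → inj₁ k₀<kr
  ; (suc s) Ps → [ inj₁ , (λ (e , s≤r) → inj₂ (e , s≤s s≤r)) ]′ (best s Ps) })
...   | tri≈ _ k₀≡kr _ = inj₂ (suc r , Pr , λ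
  { zero    _  → inj₂ (k₀≡kr , z≤n)
  ; (suc s) Ps → [ inj₁ , (λ (e , s≤r) → inj₂ (e , s≤s s≤r)) ]′ (best s Ps) })
...   | tri> _ _ kr<k₀ = inj₂ (zero , P₀ , λ
  { zero    _  → inj₂ (refl , z≤n)
  ; (suc s) Ps → inj₁ (ℕ.≤-<-trans ([ ℕ.<⇒≤ , ℕ.≤-reflexive ∘ proj₁ ]′ (best s Ps)) kr<k₀) })

module _ (w : Perm n) where

  private
    Above : Fin n → Fin n → Set
    Above q r = q < r × w ⟨$⟩ʳ q < w ⟨$⟩ʳ r

    above? : ∀ q → Decidable (Above q)
    above? q r = (q <? r) ×-dec (w ⟨$⟩ʳ q <? w ⟨$⟩ʳ r)

  cons-increasing : ∀ {q r α} → Above q r → IncreasingFrom w r α → IncreasingFrom w q (q ∷ α)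
  cons-increasing {α = _ ∷ _} (q<r , wq<wr) (increasing refl pos val) =
    increasing refl (q<r ∷ pos) (wq<wr ∷ val)

  uncons-increasing : ∀ {q x s α} → IncreasingFrom w q (x ∷ s ∷ α) →
                      x ≡ q × Above q s × IncreasingFrom w s (s ∷ α)
  uncons-increasing (increasing refl (q<s ∷ pos) (wq<ws ∷ val)) =
    refl , (q<s , wq<ws) , increasing refl pos val

  lexLastLIS-cons : ∀ q → (best : ∀ r → ∃ λ α → q < r → LexLastLIS w r α) → ∃ (LexLastLIS w q)
  lexLastLIS-cons q best with lastArgmax (above? q) (length ∘ proj₁ ∘ best)
  ... | inj₁ none = q ∷ [] , (increasing refl [-] [-] , longest) , last
    where
    longest : ∀ β → IncreasingFrom w q β → length β ℕ.≤ 1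
    longest []          _  = z≤n
    longest (_ ∷ [])    _  = s≤s z≤n
    longest (_ ∷ s ∷ β) β↗ = ⊥-elim (none s (proj₁ (proj₂ (uncons-increasing β↗))))

    last : ∀ β → LIS w q β → β ≤ₗₑₓ q ∷ []
    last []          (increasing () _ _ , _)
    last (x ∷ [])    (increasing refl _ _ , _) = next refl (base _)
    last (_ ∷ s ∷ β) (β↗ , _) = ⊥-elim (none s (proj₁ (proj₂ (uncons-increasing β↗))))
  ... | inj₂ (r , q↗r , r-best) = q ∷ ρ , (ρ↗ , longest) , last
    where
    ρ = proj₁ (best r)
    ρ-last = proj₂ (best r) (proj₁ q↗r)

    ρ↗ : IncreasingFrom w q (q ∷ ρ)
    ρ↗ = cons-increasing q↗r (proj₁ (proj₁ ρ-last))

    tail≤ : ∀ {s β} → Above q s → IncreasingFrom w s β → length β ℕ.≤ length (proj₁ (best s))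
    tail≤ {s} (q<s , _) β↗ = proj₂ (proj₁ (proj₂ (best s) q<s)) _ β↗

    best≤ : ∀ {s} → Above q s → length (proj₁ (best s)) ℕ.≤ length ρ
    best≤ q↗s = [ ℕ.<⇒≤ , ℕ.≤-reflexive ∘ proj₁ ]′ (r-best _ q↗s)

    longest : ∀ β → IncreasingFrom w q β → length β ℕ.≤ suc (length ρ)
    longest []          _  = z≤n
    longest (_ ∷ [])    _  = s≤s z≤n
    longest (_ ∷ s ∷ β) β↗ with uncons-increasing β↗
    ... | _ , q↗s , β′↗ = s≤s (ℕ.≤-trans (tail≤ q↗s β′↗) (best≤ q↗s))

    last : ∀ β → LIS w q β → β ≤ₗₑₓ q ∷ ρ
    last []       (increasing () _ _ , _)
    last (x ∷ []) (increasing refl _ _ , β-max) with ρ | β-max (q ∷ ρ) ρ↗ | proj₁ (proj₁ ρ-last)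
    ... | []    | _      | increasing () _ _
    ... | _ ∷ _ | s≤s () | _
    last (_ ∷ s ∷ β) (β↗ , β-max) with uncons-increasing β↗
    ... | refl , q↗s , β′↗ = next refl (compare (r-best s q↗s))
      where
      ρ≤β : length ρ ℕ.≤ length (s ∷ β)
      ρ≤β = ℕ.s≤s⁻¹ (β-max (q ∷ ρ) ρ↗)

      headOf : ∀ {β′} → IncreasingFrom w r β′ → s < r → (s ∷ β) ≤ₗₑₓ β′
      headOf {_ ∷ _} (increasing refl _ _) s<r =
        this s<r

      compare : length (proj₁ (best s)) ℕ.< length ρ ⊎
                (length (proj₁ (best s)) ≡ length ρ × s ≤ r) → (s ∷ β) ≤ₗₑₓ ρ
      compare (inj₁ shorter) =
        ⊥-elim (ℕ.<-irrefl refl (ℕ.<-≤-trans shorter (ℕ.≤-trans ρ≤β (tail≤ q↗s β′↗))))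
      compare (inj₂ (same , s≤r)) with s ≟ r
      ... | no s≢r   = headOf (proj₁ (proj₁ ρ-last)) (Fin.≤∧≢⇒< s≤r s≢r)
      ... | yes refl = proj₂ ρ-last (s ∷ β) (β′↗ , λ γ γ↗ → ℕ.≤-trans (tail≤ q↗s γ↗) ρ≤β)

  lexLastLIS-acc : ∀ q → Acc _>_ q → ∃ (LexLastLIS w q)
  lexLastLIS-acc q (acc rec) = lexLastLIS-cons q best
    where
    best : ∀ r → ∃ λ α → q < r → LexLastLIS w r α
    best r with q <? r
    ... | yes q<r = let α , α-last = lexLastLIS-acc r (rec q<r) in α , λ _ → α-last
    ... | no  q≮r = [] , λ q<r → ⊥-elim (q≮r q<r)

  lexLastLIS : ∀ q → ∃ (LexLastLIS w q)
  lexLastLIS q = lexLastLIS-acc q (>-wellFounded q)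

-- By LIS-length, it does not matter which element of LIS w i is measured.

rajcode : Perm n → Vec ℤ n
rajcode w = tabulate λ i → + length (proj₁ (lexLastLIS w i)) - 1ℤ

------------------------------------------------------------------------
-- The nested chain

FirstDefect : Perm n → Fin n → Set
FirstDefect w q = w ⟨$⟩ʳ q ≢ opposite q × (∀ j → j < q → w ⟨$⟩ʳ j ≡ opposite j)

IsNested : Perm n → Link n → Set
IsNested w (a , b) = ∃₂ λ q α → FirstDefect w q × LexLastLIS w q (a ∷ b ∷ α)

data IsNestedChain {n} : Perm n → List (Link n) → Set where
  []  : ∀ {w} → w ≈ w₀ → IsNestedChain w []
  _∷_ : ∀ {w a b C} → IsNested w (a , b) →
        IsNestedChain (w ·⟨ a , b ⟩) C → IsNestedChain w ((a , b) ∷ C)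

-- The rest of this section shows that every permutation has a nested
-- chain and that nested chains are climbing chains.

perm-injective : (w : Perm n) → ∀ {i j} → w ⟨$⟩ʳ i ≡ w ⟨$⟩ʳ j → i ≡ j
perm-injective w e = trans (sym (inverseˡ w)) (trans (cong (w ⟨$⟩ˡ_) e) (inverseˡ w))

module _ (w : Perm n) where

  swap-fst : ∀ a b → (w ·⟨ a , b ⟩) ⟨$⟩ʳ a ≡ w ⟨$⟩ʳ b
  swap-fst a b rewrite dec-true (a ≟ a) refl = refl

  swap-snd : ∀ a b → (w ·⟨ a , b ⟩) ⟨$⟩ʳ b ≡ w ⟨$⟩ʳ a
  swap-snd a b with b ≟ a
  ... | yes refl = refl
  ... | no  _ rewrite dec-true (b ≟ b) refl = refl

  swap-other : ∀ a b {k} → k ≢ a → k ≢ b → (w ·⟨ a , b ⟩) ⟨$⟩ʳ k ≡ w ⟨$⟩ʳ k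
  swap-other a b {k} k≢a k≢b rewrite dec-false (k ≟ a) k≢a | dec-false (k ≟ b) k≢b = refl

-- Comparing sums whose terms are comparable away from one or two indices.

sum-≤-except : ∀ {m} (F G : Fin m → ℕ) a → (∀ i → i ≢ a → F i ℕ.≤ G i) →
               sum F + G a ℕ.≤ sum G + F a
sum-≤-except F G zero F≤G = subst₂ ℕ._≤_
  (shuffle (F zero) _ _) (shuffle′ (G zero) _ _)
  (ℕ.+-monoʳ-≤ (F zero + G zero) (sum-mono λ i → F≤G (suc i) λ ()))
  where
  sum-mono : ∀ {m} {f g : Fin m → ℕ} → (∀ i → f i ℕ.≤ g i) → sum f ℕ.≤ sum g
  sum-mono {zero}  _   = z≤n
  sum-mono {suc m} f≤g = ℕ.+-mono-≤ (f≤g zero) (sum-mono (f≤g ∘ suc))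
  shuffle : ∀ x y z → x + y + z ≡ x + z + y
  shuffle = solve-∀
  shuffle′ : ∀ x y z → y + x + z ≡ x + z + y
  shuffle′ = solve-∀
sum-≤-except F G (suc a) F≤G = subst₂ ℕ._≤_
  (sym (ℕ.+-assoc (F zero) _ _)) (sym (ℕ.+-assoc (G zero) _ _))
  (ℕ.+-mono-≤ (F≤G zero λ ())
    (sum-≤-except (F ∘ suc) (G ∘ suc) a λ i i≢a → F≤G (suc i) (i≢a ∘ Fin.suc-injective)))

sum-≤-except₂ : ∀ {m} (F G : Fin m → ℕ) a b → a ≢ b →
                (∀ i → i ≢ a → i ≢ b → F i ℕ.≤ G i) →
                sum F + (G a + G b) ℕ.≤ sum G + (F a + F b)
sum-≤-except₂ {m} F G a b a≢b F≤G = ℕ.+-cancelʳ-≤ (sum H) _ _ (subst₂ ℕ._≤_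
  (shuffle (sum F) (G a) (sum H) (G b)) (shuffle′ (sum H) (F a) (sum G) (F b))
  (ℕ.+-mono-≤ F≤H H≤G))
  where
  H : Fin m → ℕ
  H i = if does (i ≟ a) then G a else F i
  Ha : H a ≡ G a
  Ha rewrite dec-true (a ≟ a) refl = refl
  Hi : ∀ {i} → i ≢ a → H i ≡ F i
  Hi {i} i≢a rewrite dec-false (i ≟ a) i≢a = refl
  F≤H : sum F + G a ℕ.≤ sum H + F a
  F≤H = subst (λ x → sum F + x ℕ.≤ sum H + F a) Ha
    (sum-≤-except F H a λ i i≢a → ℕ.≤-reflexive (sym (Hi i≢a)))
  H≤ : ∀ i → i ≢ b → H i ℕ.≤ G i
  H≤ i i≢b with i ≟ a
  ... | yes refl = ℕ.≤-refl
  ... | no  i≢a  = F≤G i i≢a i≢b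
  H≤G : sum H + G b ℕ.≤ sum G + F b
  H≤G = subst (λ x → sum H + G b ℕ.≤ sum G + x) (Hi (a≢b ∘ sym)) (sum-≤-except H G b H≤)
  shuffle : ∀ x y z t → (x + y) + (z + t) ≡ x + (y + t) + z
  shuffle = solve-∀
  shuffle′ : ∀ x y z t → (x + y) + (z + t) ≡ z + (y + t) + x
  shuffle′ = solve-∀

sum₂-≤-except₂ : ∀ {m} (f g : Fin m → Fin m → ℕ) a b → a ≢ b →
  (∀ i j → i ≢ a → i ≢ b → j ≢ a → j ≢ b → f i j ℕ.≤ g i j) →
  (∀ i → i ≢ a → i ≢ b → f i a + f i b ℕ.≤ g i a + g i b) →
  (∀ j → j ≢ a → j ≢ b → f a j + f b j ℕ.≤ g a j + g b j) →
  sum (λ i → sum (f i)) + ((g a a + g b a) + (g a b + g b b)) ℕ.≤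
  sum (λ i → sum (g i)) + ((f a a + f b a) + (f a b + f b b))
sum₂-≤-except₂ {m} f g a b a≢b off row col =
  ℕ.+-cancelʳ-≤ (gab + fab) _ _ (subst₂ ℕ._≤_
    (shuffle (sum R) gab fab gblock) (shuffle′ (sum S) fab gab fblock) (ℕ.+-mono-≤ rows cols))
  where
  R S : Fin m → ℕ
  R i = sum (f i)
  S i = sum (g i)
  gab = S a + S b
  fab = R a + R b
  gblock = (g a a + g b a) + (g a b + g b b)
  fblock = (f a a + f b a) + (f a b + f b b)
  R≤S : ∀ i → i ≢ a → i ≢ b → R i ℕ.≤ S i
  R≤S i i≢a i≢b = ℕ.+-cancelʳ-≤ (g i a + g i b) _ _ (ℕ.≤-trans
    (sum-≤-except₂ (f i) (g i) a b a≢b λ j → off i j i≢a i≢b)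
    (ℕ.+-monoʳ-≤ (S i) (row i i≢a i≢b)))
  rows : sum R + gab ℕ.≤ sum S + fab
  rows = sum-≤-except₂ R S a b a≢b R≤S
  cols : fab + gblock ℕ.≤ gab + fblock
  cols = subst₂ (λ x y → x + gblock ℕ.≤ y + fblock) (Sum.∑-distrib-+ (f a) (f b)) (Sum.∑-distrib-+ (g a) (g b))
    (sum-≤-except₂ (λ j → f a j + f b j) (λ j → g a j + g b j) a b a≢b col)
  shuffle : ∀ x y z t → (x + y) + (z + t) ≡ x + t + (y + z)
  shuffle = solve-∀
  shuffle′ : ∀ x y z t → (x + y) + (z + t) ≡ x + t + (z + y)
  shuffle′ = solve-∀

-- coinv w is the number of non-inversions of w.

lt : Fin n → Fin n → ℕ
lt i j = if does (i <? j) then 1 else 0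

coinv : Perm n → ℕ
coinv w = sum λ i → sum λ j → lt i j * lt (w ⟨$⟩ʳ i) (w ⟨$⟩ʳ j)

lt-yes : {i j : Fin n} → i < j → lt i j ≡ 1
lt-yes {i = i} {j} i<j rewrite dec-true (i <? j) i<j = refl

lt-no : {i j : Fin n} → ¬ i < j → lt i j ≡ 0
lt-no {i = i} {j} i≮j rewrite dec-false (i <? j) i≮j = refl

lt-mono : {i j k l : Fin n} → (i < j → k < l) → lt i j ℕ.≤ lt k l
lt-mono {i = i} {j} {k} {l} imp with i <? j
... | no  i≮j = subst (ℕ._≤ lt k l) (sym (lt-no i≮j)) z≤n
... | yes i<j = ℕ.≤-reflexive (trans (lt-yes i<j) (sym (lt-yes (imp i<j))))

lt-cong : {i j k l : Fin n} → (i < j → k < l) → (k < l → i < j) → lt i j ≡ lt k l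
lt-cong to from = ℕ.≤-antisym (lt-mono to) (lt-mono from)

rearrange-≤ : ∀ {p p′ x x′} → p ℕ.≤ p′ → x ℕ.≤ x′ → p * x′ + p′ * x ℕ.≤ p * x + p′ * x′
rearrange-≤ {p} {p′} {x} {x′} p≤p′ x≤x′ = subst₂
  (λ q y → p * y + q * x ℕ.≤ p * x + q * y) (ℕ.m+[n∸m]≡n p≤p′) (ℕ.m+[n∸m]≡n x≤x′)
  (ℕ.≤-trans (ℕ.m≤m+n _ ((p′ ℕ.∸ p) * (x′ ℕ.∸ x)))
    (ℕ.≤-reflexive (expand p (p′ ℕ.∸ p) x (x′ ℕ.∸ x))))
  where
  expand : ∀ p d x e → p * (x + e) + (p + d) * x + d * e ≡ p * x + (p + d) * (x + e)
  expand = solve-∀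

rearrange-≡ : ∀ {p p′ x x′} → p ≡ p′ ⊎ x ≡ x′ → p * x + p′ * x′ ≡ p * x′ + p′ * x
rearrange-≡ {p} {x = x} {x′} (inj₁ refl) = ℕ.+-comm (p * x) (p * x′)
rearrange-≡ (inj₂ refl) = refl

module _ (w v : Perm n) {a b : Fin n} (a<b : a < b) (wa<wb : w ⟨$⟩ʳ a < w ⟨$⟩ʳ b)
         (v≈ : v ≈ w ·⟨ a , b ⟩) where

  private
    f g : Fin n → Fin n → ℕ
    f i j = lt i j * lt (w ⟨$⟩ʳ i) (w ⟨$⟩ʳ j)
    g i j = lt i j * lt (v ⟨$⟩ʳ i) (v ⟨$⟩ʳ j)

    a≢b : a ≢ b
    a≢b = Fin.<⇒≢ a<b

    va : v ⟨$⟩ʳ a ≡ w ⟨$⟩ʳ b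
    va = trans (v≈ a) (swap-fst w a b)
    vb : v ⟨$⟩ʳ b ≡ w ⟨$⟩ʳ a
    vb = trans (v≈ b) (swap-snd w a b)
    vk : ∀ {k} → k ≢ a → k ≢ b → v ⟨$⟩ʳ k ≡ w ⟨$⟩ʳ k
    vk k≢a k≢b = trans (v≈ _) (swap-other w a b k≢a k≢b)

    off : ∀ i j → i ≢ a → i ≢ b → j ≢ a → j ≢ b → g i j ≡ f i j
    off i j i≢a i≢b j≢a j≢b = cong₂ (λ x y → lt i j * lt x y) (vk i≢a i≢b) (vk j≢a j≢b)

    g-row : ∀ i → i ≢ a → i ≢ b → g i a + g i b ≡
            lt i a * lt (w ⟨$⟩ʳ i) (w ⟨$⟩ʳ b) + lt i b * lt (w ⟨$⟩ʳ i) (w ⟨$⟩ʳ a)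
    g-row i i≢a i≢b rewrite va | vb | vk i≢a i≢b = refl

    g-col : ∀ j → j ≢ a → j ≢ b → g b j + g a j ≡
            lt b j * lt (w ⟨$⟩ʳ a) (w ⟨$⟩ʳ j) + lt a j * lt (w ⟨$⟩ʳ b) (w ⟨$⟩ʳ j)
    g-col j j≢a j≢b rewrite va | vb | vk j≢a j≢b = refl

    f-block : (f a a + f b a) + (f a b + f b b) ≡ 1
    f-block rewrite lt-no (Fin.<-irrefl {x = a} refl) | lt-no (Fin.<-irrefl {x = b} refl)
                  | lt-no (Fin.<-asym a<b) | lt-yes a<b | lt-yes wa<wb = refl

    g-block : (g a a + g b a) + (g a b + g b b) ≡ 0
    g-block rewrite lt-no (Fin.<-irrefl {x = a} refl) | lt-no (Fin.<-irrefl {x = b} refl)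
                  | lt-no (Fin.<-asym a<b) | lt-yes a<b | va | vb
                  | lt-no (Fin.<-asym wa<wb) = refl

  coinv-step : coinv v ℕ.< coinv w
  coinv-step = subst₂ ℕ._≤_ (trans (cong (coinv v ℕ.+_) f-block) (ℕ.+-comm (coinv v) 1))
    (trans (cong (coinv w ℕ.+_) g-block) (ℕ.+-identityʳ (coinv w)))
    (sum₂-≤-except₂ g f a b a≢b
      (λ i j i≢a i≢b j≢a j≢b → ℕ.≤-reflexive (off i j i≢a i≢b j≢a j≢b))
      (λ i i≢a i≢b → subst (ℕ._≤ f i a + f i b) (sym (g-row i i≢a i≢b))
        (rearrange-≤ (lt-mono λ i<a → Fin.<-trans i<a a<b) (lt-mono λ x → Fin.<-trans x wa<wb)))
      (λ j j≢a j≢b → subst₂ ℕ._≤_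
        (trans (sym (g-col j j≢a j≢b)) (ℕ.+-comm (g b j) (g a j))) (ℕ.+-comm (f b j) (f a j))
        (rearrange-≤ {lt b j} {lt a j} {lt (w ⟨$⟩ʳ b) (w ⟨$⟩ʳ j)} {lt (w ⟨$⟩ʳ a) (w ⟨$⟩ʳ j)}
          (lt-mono {i = b} {j} {a} {j} λ b<j → Fin.<-trans {j = b} a<b b<j)
          (lt-mono {i = w ⟨$⟩ʳ b} {w ⟨$⟩ʳ j} {w ⟨$⟩ʳ a} {w ⟨$⟩ʳ j}
            λ x → Fin.<-trans {j = w ⟨$⟩ʳ b} wa<wb x))))

  coinv-minimal-step :
    (∀ k → a < k → k < b → w ⟨$⟩ʳ a < w ⟨$⟩ʳ k → ¬ w ⟨$⟩ʳ k < w ⟨$⟩ʳ b) →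
    coinv w ℕ.≤ suc (coinv v)
  coinv-minimal-step gap = subst₂ ℕ._≤_
    (trans (cong (coinv w ℕ.+_) g-block) (ℕ.+-identityʳ (coinv w)))
    (trans (cong (coinv v ℕ.+_) f-block) (ℕ.+-comm (coinv v) 1))
    (sum₂-≤-except₂ f g a b a≢b
      (λ i j i≢a i≢b j≢a j≢b → ℕ.≤-reflexive (sym (off i j i≢a i≢b j≢a j≢b)))
      (λ i i≢a i≢b → ℕ.≤-reflexive (trans (rearrange-≡ (row i i≢a i≢b)) (sym (g-row i i≢a i≢b))))
      (λ j j≢a j≢b → ℕ.≤-reflexive (trans (ℕ.+-comm (f a j) (f b j))
        (trans (rearrange-≡ (col j j≢a j≢b)) (trans (sym (g-col j j≢a j≢b)) (ℕ.+-comm (g b j) (g a j)))))))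
    where
    wk≢ : ∀ {k l} → k ≢ l → w ⟨$⟩ʳ k ≢ w ⟨$⟩ʳ l
    wk≢ k≢l = k≢l ∘ perm-injective w

    side : ∀ k → k ≢ a → k ≢ b →
           (k < a ⊎ b < k) ⊎ (w ⟨$⟩ʳ k < w ⟨$⟩ʳ a ⊎ w ⟨$⟩ʳ b < w ⟨$⟩ʳ k)
    side k k≢a k≢b with Fin.<-cmp k a | Fin.<-cmp k b
    ... | tri< k<a _ _ | _            = inj₁ (inj₁ k<a)
    ... | tri≈ _ k≡a _ | _            = ⊥-elim (k≢a k≡a)
    ... | tri> _ _ _   | tri> _ _ b<k = inj₁ (inj₂ b<k)
    ... | tri> _ _ _   | tri≈ _ k≡b _ = ⊥-elim (k≢b k≡b)
    ... | tri> _ _ a<k | tri< k<b _ _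
      with Fin.<-cmp (w ⟨$⟩ʳ k) (w ⟨$⟩ʳ a) | Fin.<-cmp (w ⟨$⟩ʳ k) (w ⟨$⟩ʳ b)
    ...   | tri< x _ _ | _          = inj₂ (inj₁ x)
    ...   | tri≈ _ x _ | _          = ⊥-elim (wk≢ k≢a x)
    ...   | tri> _ _ _ | tri> _ _ y = inj₂ (inj₂ y)
    ...   | tri> _ _ _ | tri≈ _ y _ = ⊥-elim (wk≢ k≢b y)
    ...   | tri> _ _ x | tri< y _ _ = ⊥-elim (gap k a<k k<b x y)

    below : ∀ {k x y : Fin n} → k < x ⊎ y < k → x < y → lt k x ≡ lt k y
    below (inj₁ k<x) x<y = lt-cong (λ _ → Fin.<-trans k<x x<y) (λ _ → k<x)
    below (inj₂ y<k) x<y = lt-cong (λ k<x → Fin.<-trans k<x x<y) (λ k<y → ⊥-elim (Fin.<-asym k<y y<k))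

    above : ∀ {k x y : Fin n} → k < x ⊎ y < k → x < y → lt y k ≡ lt x k
    above (inj₁ k<x) x<y = lt-cong (λ y<k → Fin.<-trans x<y y<k) (λ x<k → ⊥-elim (Fin.<-asym k<x x<k))
    above (inj₂ y<k) x<y = lt-cong (λ _ → Fin.<-trans x<y y<k) (λ _ → y<k)

    row : ∀ i → i ≢ a → i ≢ b →
          lt i a ≡ lt i b ⊎ lt (w ⟨$⟩ʳ i) (w ⟨$⟩ʳ a) ≡ lt (w ⟨$⟩ʳ i) (w ⟨$⟩ʳ b)
    row i i≢a i≢b = [ (λ s → inj₁ (below s a<b)) , (λ s → inj₂ (below s wa<wb)) ]′ (side i i≢a i≢b)

    col : ∀ j → j ≢ a → j ≢ b →
          lt b j ≡ lt a j ⊎ lt (w ⟨$⟩ʳ b) (w ⟨$⟩ʳ j) ≡ lt (w ⟨$⟩ʳ a) (w ⟨$⟩ʳ j)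
    col j j≢a j≢b = [ (λ s → inj₁ (above s a<b)) , (λ s → inj₂ (above s wa<wb)) ]′ (side j j≢a j≢b)

coinv-<ᴮ : {u v : Perm n} → u <ᴮ v → coinv v ℕ.< coinv u
coinv-<ᴮ {u = u} {v} [ i , j , i<j , ui<uj , v≈ ] = coinv-step u v i<j ui<uj v≈
coinv-<ᴮ {u = u} (_∷_ {y = z} (i , j , i<j , ui<uj , z≈) z<v) =
  ℕ.<-trans (coinv-<ᴮ z<v) (coinv-step u z i<j ui<uj z≈)

minimal-step-⋖ : (w : Perm n) {a b : Fin n} → a < b → w ⟨$⟩ʳ a < w ⟨$⟩ʳ b →
  (∀ k → a < k → k < b → w ⟨$⟩ʳ a < w ⟨$⟩ʳ k → ¬ w ⟨$⟩ʳ k < w ⟨$⟩ʳ b) →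
  w ⋖ w ·⟨ a , b ⟩
minimal-step-⋖ w {a} {b} a<b wa<wb gap =
  [ a , b , a<b , wa<wb , (λ _ → refl) ] , λ (z , w<z , z<v) →
    ℕ.<⇒≱ (ℕ.<-≤-trans (s≤s (coinv-<ᴮ z<v)) (coinv-<ᴮ w<z))
          (coinv-minimal-step w (w ·⟨ a , b ⟩) a<b wa<wb (λ _ → refl) gap)

-- A first defect exists, and it is the start of some ascent.

firstDefect : (w : Perm n) → ¬ w ≈ w₀ → ∃ (FirstDefect w)
firstDefect w w≉w₀ with Fin.¬∀⟶∃¬-smallest _ _ (λ i → w ⟨$⟩ʳ i ≟ opposite i) w≉w₀
... | q , wq≢ , before = q , wq≢ , λ j j<q →
  subst (λ i → w ⟨$⟩ʳ i ≡ opposite i) (Fin.toℕ-injective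
    (trans (Fin.toℕ-inject (fromℕ< j<q)) (Fin.toℕ-fromℕ< j<q))) (before (fromℕ< j<q))

opposite-anti : {i j : Fin n} → opposite i < j → opposite j < i
opposite-anti {n} {i} {j} oi<j = subst₂ ℕ._<_ (sym (Fin.opposite-prop j))
  (trans (sym (Fin.opposite-prop (opposite i))) (cong toℕ (Fin.opposite-involutive i)))
  (ℕ.∸-monoʳ-< (s≤s oi<j) (Fin.toℕ<n j))

defect-ascent : (w : Perm n) (q : Fin n) → FirstDefect w q →
                ∃ λ r → q < r × w ⟨$⟩ʳ q < w ⟨$⟩ʳ r
defect-ascent w q (wq≢ , before) = r , q<r , subst (w ⟨$⟩ʳ q <_) (sym wr) wq<
  where
  r = w ⟨$⟩ˡ opposite q
  wr : w ⟨$⟩ʳ r ≡ opposite q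
  wr = inverseʳ w
  opposite-injective : ∀ {i j : Fin _} → opposite i ≡ opposite j → i ≡ j
  opposite-injective = perm-injective w₀
  q<r : q < r
  q<r with Fin.<-cmp q r
  ... | tri< q<r _ _ = q<r
  ... | tri≈ _ q≡r _ = ⊥-elim (wq≢ (trans (cong (w ⟨$⟩ʳ_) q≡r) wr))
  ... | tri> _ _ r<q = ⊥-elim (Fin.<⇒≢ r<q (opposite-injective (trans (sym (before r r<q)) wr)))
  wq< : w ⟨$⟩ʳ q < opposite q
  wq< with Fin.<-cmp (w ⟨$⟩ʳ q) (opposite q)
  ... | tri< wq<oq _ _ = wq<oq
  ... | tri≈ _ wq≡ _ = ⊥-elim (wq≢ wq≡)
  ... | tri> _ _ oq<wq = ⊥-elim (Fin.<⇒≢ j<q (perm-injective w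
      (trans (before _ j<q) (Fin.opposite-involutive (w ⟨$⟩ʳ q)))))
    where
    j<q : opposite (w ⟨$⟩ʳ q) < q
    j<q = opposite-anti oq<wq

nested : (w : Perm n) → ¬ w ≈ w₀ → ∃ (IsNested w)
nested w w≉w₀ with firstDefect w w≉w₀
... | q , defect with lexLastLIS w q | defect-ascent w q defect
...   | (a ∷ b ∷ α) , last | _ = (a , b) , q , α , defect , last
...   | [] , (increasing () _ _ , _) , _ | _
...   | (_ ∷ []) , (_ , longest) , _ | r , q<r , wq<wr =
  ⊥-elim (ℕ.<⇒≱ (s≤s (s≤s z≤n))
    (longest (q ∷ r ∷ []) (increasing refl (q<r ∷ [-]) (wq<wr ∷ [-]))))

nested-start : (w : Perm n) {a b q : Fin n} {α : List (Fin n)} →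
               LexLastLIS w q (a ∷ b ∷ α) → a ≡ q × a < b × w ⟨$⟩ʳ a < w ⟨$⟩ʳ b
nested-start w ((increasing refl (a<b ∷ _) (wa<wb ∷ _) , _) , _) = refl , a<b , wa<wb

nested-⋖ : (w : Perm n) {a b : Fin n} → IsNested w (a , b) → a < b × w ⋖ w ·⟨ a , b ⟩
nested-⋖ w {a} {b} (q , α , _ , (increasing refl (a<b ∷ pos) (wa<wb ∷ val) , longest) , _) =
  a<b , minimal-step-⋖ w a<b wa<wb λ k a<k k<b wa<wk wk<wb →
    ℕ.<-irrefl refl (longest (a ∷ k ∷ b ∷ α)
      (increasing refl (a<k ∷ k<b ∷ pos) (wa<wk ∷ wk<wb ∷ val)))

nestedChain-acc : (w : Perm n) → Acc ℕ._<_ (coinv w) → ∃ (IsNestedChain w)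
nestedChain-acc w (acc rec) with Fin.all? (λ i → w ⟨$⟩ʳ i ≟ w₀ ⟨$⟩ʳ i)
... | yes w≈w₀ = [] , [] w≈w₀
... | no  w≉w₀ with nested w w≉w₀
...   | (a , b) , isNested@(_ , _ , _ , last) with nested-start w last
...     | _ , a<b , wa<wb with nestedChain-acc (w ·⟨ a , b ⟩)
                                 (rec (coinv-step w (w ·⟨ a , b ⟩) a<b wa<wb λ _ → refl))
...       | C , isChain = (a , b) ∷ C , isNested ∷ isChain

nestedChain : (w : Perm n) → ∃ (IsNestedChain w)
nestedChain w = nestedChain-acc w (ℕ.<-wellFounded (coinv w))

nestedChain-climbs : {w : Perm n} {C : List (Link n)} → IsNestedChain w C → ClimbsTo-w₀ w C
nestedChain-climbs ([] w≈w₀)       = [] w≈w₀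
nestedChain-climbs (isNested ∷ C) = nested-⋖ _ isNested ∷ nestedChain-climbs C

nested-≤-next : (w : Perm n) {a b a′ b′ : Fin n} → IsNested w (a , b) →
                IsNested (w ·⟨ a , b ⟩) (a′ , b′) → a ≤ a′
nested-≤-next w {a} {b} (q , _ , (_ , before) , last) (q′ , _ , (defect , _) , last′)
  with nested-start w last | nested-start (w ·⟨ a , b ⟩) last′
... | refl , a<b , _ | refl , _ = ℕ.≮⇒≥ λ q′<q → defect (trans
  (swap-other w a b (Fin.<⇒≢ q′<q) (Fin.<⇒≢ (Fin.<-trans q′<q a<b))) (before q′ q′<q))

nestedChain-monotone : {w : Perm n} {C : List (Link n)} →
                       IsNestedChain w C → Linked (_≤_ on proj₁) C
nestedChain-monotone ([] _)                  = []
nestedChain-monotone (_ ∷ [] _)              = [-]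
nestedChain-monotone (isNested ∷ C@(isNested′ ∷ _)) =
  nested-≤-next _ isNested isNested′ ∷ nestedChain-monotone C

Cᴺ : (w : Perm n) → ClimbingChain w
Cᴺ w = record
  { links    = proj₁ (nestedChain w)
  ; climbing = nestedChain-climbs (proj₂ (nestedChain w))
  ; monotone = nestedChain-monotone (proj₂ (nestedChain w))
  }

ξ : (w : Perm n) → MarkedChain w
ξ w = record
  { chain    = Cᴺ w
  ; marked   = minimalMarkings (ClimbingChain.links (Cᴺ w))
  ; minimal⊆ = Sublist.⊆-refl
  ; marked⊆  = minimalMarkings-⊆ (ClimbingChain.links (Cᴺ w))
  }

{-# OPTIONS --safe #-}

-- Let w′ = w t_{ab} be the first step of the nested chain.  Maximality of the
-- subsequence (a, b, …) rules out values strictly between w(a) and w(b) at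
-- positions between a and b, and its being lexicographically last means that
-- lowering the value at b to w(a) creates no longer subsequence from b; so LIS
-- lengths agree in w and w′ at every position except a.  At a the length drops
-- by one if the next link is a minimal marking and is unchanged otherwise.

module Submission where

open import Data.Empty using (⊥-elim)
open import Data.Fin.Base using (Fin; opposite; _<_; _≤_)
open import Data.Fin.Permutation using (_⟨$⟩ʳ_)
open import Data.Fin.Properties as Fin using (_≟_)
open import Data.Integer.Base using (+_; _-_; 1ℤ)
open import Data.List.Base using (List; []; _∷_; length; filter)
open import Data.List.Properties using (filter-accept; filter-reject)
open import Data.List.Relation.Binary.Lex.Strict using (this; next)
open import Data.List.Relation.Unary.Linked using ([-])
open import Data.Nat.Base as ℕ using (ℕ; suc; z≤n; s≤s)
import Data.Nat.Properties as ℕ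
open import Data.Product.Base using (_×_; _,_; proj₁; proj₂)
open import Data.Sum.Base using (inj₁; inj₂; [_,_]′)
open import Data.Vec.Properties using (tabulate-cong)
open import Relation.Binary.Definitions using (tri<; tri≈; tri>)
open import Relation.Binary.PropositionalEquality
  using (_≡_; _≢_; refl; sym; trans; cong; subst; subst₂)
open import Relation.Nullary using (¬_; yes; no)
open import Relation.Nullary.Decidable using (toSum)
open import Defs

private
  variable
    n : ℕ

-- Longest increasing subsequence lengths via ascents.

lis : Perm n → Fin n → ℕ
lis w q = length (proj₁ (lexLastLIS w q))

module _ (w : Perm n) where

  Ascent : Fin n → Fin n → Set
  Ascent q r = q < r × w ⟨$⟩ʳ q < w ⟨$⟩ʳ r

  lis-bound : ∀ {q β} → IncreasingFrom w q β → length β ℕ.≤ lis w q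
  lis-bound {q} = proj₂ (proj₁ (proj₂ (lexLastLIS w q))) _

  lis-least : ∀ {q m} → (∀ β → IncreasingFrom w q β → length β ℕ.≤ m) → lis w q ℕ.≤ m
  lis-least {q} bound = bound _ (proj₁ (proj₁ (proj₂ (lexLastLIS w q))))

  LIS⇒lis : ∀ {q α} → LIS w q α → length α ≡ lis w q
  LIS⇒lis {q} α-lis = LIS-length w q α-lis (proj₁ (proj₂ (lexLastLIS w q)))

  lis-positive : ∀ {q} → 1 ℕ.≤ lis w q
  lis-positive {q} = lis-bound (increasing {α = q ∷ []} refl [-] [-])

  lis-ascent : ∀ {q r} → Ascent q r → suc (lis w r) ℕ.≤ lis w q
  lis-ascent {r = r} q↗r =
    lis-bound (cons-increasing w q↗r (proj₁ (proj₁ (proj₂ (lexLastLIS w r)))))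

  -- Together with `lis-ascent`, this replaces reasoning about whole subsequences by reasoning about
  -- their first step.
  lis-rec-≤ : ∀ {q m} → 1 ℕ.≤ m → (∀ r → Ascent q r → suc (lis w r) ℕ.≤ m) → lis w q ℕ.≤ m
  lis-rec-≤ {q} {m} 1≤m step = lis-least bound
    where
    bound : ∀ β → IncreasingFrom w q β → length β ℕ.≤ m
    bound []          _  = z≤n
    bound (_ ∷ [])    _  = 1≤m
    bound (_ ∷ s ∷ β) β↗ with uncons-increasing w β↗
    ... | _ , q↗s , β′↗ = ℕ.≤-trans (s≤s (lis-bound β′↗)) (step s q↗s)

  -- Along such a prefix the largest values occur in decreasing order, so every value exceeding the
  -- one at `q` sits before `q` and no ascent leaves `q`.
  lis-before-defect : ∀ {q} → (∀ j → j ≤ q → w ⟨$⟩ʳ j ≡ opposite j) → lis w q ≡ 1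
  lis-before-defect {q} before = ℕ.≤-antisym
    (lis-rec-≤ ℕ.≤-refl λ r q↗r → ⊥-elim (no-ascent r q↗r)) lis-positive
    where
    no-ascent : ∀ r → ¬ Ascent q r
    no-ascent r (q<r , wq<wr) = Fin.<-asym q<r (subst (_< q) j≡r j<q)
      where
      j<q : opposite (w ⟨$⟩ʳ r) < q
      j<q = opposite-anti (subst (_< w ⟨$⟩ʳ r) (before q ℕ.≤-refl) wq<wr)
      j≡r : opposite (w ⟨$⟩ʳ r) ≡ r
      j≡r = perm-injective w (trans (before _ (ℕ.<⇒≤ j<q)) (Fin.opposite-involutive _))

  -- The lexicographically last subsequence.

  module _ {q a b α} (last : LexLastLIS w q (a ∷ b ∷ α)) where

    lexLast-ascent : Ascent q b
    lexLast-ascent with refl , q↗b ← nested-start w last = q↗b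

    lexLast-lis : lis w q ≡ suc (lis w b)
    lexLast-lis with uncons-increasing w (proj₁ (proj₁ last))
    ... | _ , q↗b , tail↗ = ℕ.≤-antisym
      (ℕ.≤-trans (ℕ.≤-reflexive (sym (LIS⇒lis (proj₁ last)))) (s≤s (lis-bound tail↗)))
      (lis-ascent q↗b)

    -- Otherwise `q` followed by a longest subsequence from `d` would also be longest from `q`, and
    -- lexicographically later because `b < d`.
    lexLast-later : ∀ {d} → b < d → Ascent q d → lis w d ℕ.< lis w b
    lexLast-later {d} b<d q↗d = ℕ.≰⇒> λ b≤d → later-impossible
      (proj₁ (proj₁ δ-lis)) (proj₂ last (q ∷ δ) (qδ↗ , λ β β↗ →
        ℕ.≤-trans (lis-bound β↗) (ℕ.≤-trans (ℕ.≤-reflexive lexLast-lis) (s≤s b≤d))))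
      where
      δ = proj₁ (lexLastLIS w d)
      δ-lis = proj₂ (lexLastLIS w d)
      qδ↗ = cons-increasing w q↗d (proj₁ (proj₁ δ-lis))
      a≡q : a ≡ q
      a≡q = proj₁ (nested-start w last)
      later-impossible : ∀ {δ} → IncreasingFrom w d δ → ¬ (q ∷ δ ≤ₗₑₓ a ∷ b ∷ α)
      later-impossible _ (this q<a) = Fin.<-irrefl (sym a≡q) q<a
      later-impossible {_ ∷ _} (increasing refl _ _) (next _ (this d<b)) = Fin.<-asym b<d d<b
      later-impossible {_ ∷ _} (increasing refl _ _) (next _ (next d≡b _)) =
        Fin.<-irrefl (sym d≡b) b<d

    -- Inserting `k` between `q` and `b` would beat `lis w q`.
    lexLast-gap : ∀ {k} → Ascent q k → ¬ Ascent k b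
    lexLast-gap q↗k k↗b = ℕ.<⇒≱ (lis-ascent q↗k)
      (ℕ.≤-trans (ℕ.≤-reflexive lexLast-lis) (lis-ascent k↗b))

-- Effect of one nested step on the lengths.

module NestedStep (w : Perm n) {a b : Fin n} {α : List (Fin n)}
                  (defect : FirstDefect w a) (last : LexLastLIS w a (a ∷ b ∷ α)) where

  w′ : Perm n
  w′ = w ·⟨ a , b ⟩

  a<b : a < b
  a<b = proj₁ (lexLast-ascent w last)

  wa<wb : w ⟨$⟩ʳ a < w ⟨$⟩ʳ b
  wa<wb = proj₂ (lexLast-ascent w last)

  w′a : w′ ⟨$⟩ʳ a ≡ w ⟨$⟩ʳ b
  w′a = swap-fst w a b

  w′b : w′ ⟨$⟩ʳ b ≡ w ⟨$⟩ʳ a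
  w′b = swap-snd w a b

  w′-other : ∀ {k} → a < k → k ≢ b → w′ ⟨$⟩ʳ k ≡ w ⟨$⟩ʳ k
  w′-other a<k = swap-other w a b (λ k≡a → Fin.<⇒≢ a<k (sym k≡a))

  w′-before : ∀ {k} → k < a → w′ ⟨$⟩ʳ k ≡ opposite k
  w′-before k<a = trans
    (swap-other w a b (Fin.<⇒≢ k<a) (Fin.<⇒≢ (Fin.<-trans k<a a<b)))
    (proj₂ defect _ k<a)

  below-b : ∀ {k} → a < k → k < b → w ⟨$⟩ʳ k < w ⟨$⟩ʳ b → w ⟨$⟩ʳ k < w ⟨$⟩ʳ a
  below-b {k} a<k k<b wk<wb with Fin.<-cmp (w ⟨$⟩ʳ k) (w ⟨$⟩ʳ a)
  ... | tri< wk<wa _ _ = wk<wa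
  ... | tri≈ _ wk≡wa _ = ⊥-elim (Fin.<⇒≢ a<k (sym (perm-injective w wk≡wa)))
  ... | tri> _ _ wa<wk = ⊥-elim (lexLast-gap w last (a<k , wa<wk) (k<b , wk<wb))

  -- Beyond `a` only the value at `b` changes, and it falls. The ascents at risk are those ending at
  -- `b`, and `below-b` saves them.
  ascent⇒ascent′ : ∀ {k r} → a < k → Ascent w k r → Ascent w′ k r
  ascent⇒ascent′ {k} {r} a<k (k<r , wk<wr) with k ≟ b | r ≟ b
  ... | yes refl | yes refl = ⊥-elim (Fin.<-irrefl refl k<r)
  ... | yes refl | no r≢b   = k<r , subst₂ _<_ (sym w′b)
    (sym (w′-other (Fin.<-trans a<k k<r) r≢b)) (Fin.<-trans wa<wb wk<wr)
  ... | no k≢b   | yes refl = k<r , subst₂ _<_ (sym (w′-other a<k k≢b)) (sym w′b)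
    (below-b a<k k<r wk<wr)
  ... | no k≢b   | no r≢b   = k<r , subst₂ _<_ (sym (w′-other a<k k≢b))
    (sym (w′-other (Fin.<-trans a<k k<r) r≢b)) wk<wr

  ascent′⇒ascent : ∀ {k r} → a < k → k ≢ b → Ascent w′ k r → Ascent w k r
  ascent′⇒ascent {k} {r} a<k k≢b (k<r , w′k<w′r) with r ≟ b
  ... | yes refl = k<r , Fin.<-trans (subst₂ _<_ (w′-other a<k k≢b) w′b w′k<w′r) wa<wb
  ... | no r≢b   = k<r ,
    subst₂ _<_ (w′-other a<k k≢b) (w′-other (Fin.<-trans a<k k<r) r≢b) w′k<w′r

  ascent′-b : ∀ {r} → Ascent w′ b r → Ascent w a r
  ascent′-b (b<r , w′b<w′r) = Fin.<-trans a<b b<r ,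
    subst₂ _<_ w′b (w′-other (Fin.<-trans a<b b<r) (λ r≡b → Fin.<⇒≢ b<r (sym r≡b))) w′b<w′r

  ascent′-a : ∀ {r} → Ascent w′ a r → r ≢ b × w ⟨$⟩ʳ b < w ⟨$⟩ʳ r
  ascent′-a {r} (a<r , w′a<w′r) = r≢b , subst₂ _<_ w′a (w′-other a<r r≢b) w′a<w′r
    where
    r≢b : r ≢ b
    r≢b refl = Fin.<-asym wa<wb (subst₂ _<_ w′a w′b w′a<w′r)

  lis≤lis′ : ∀ {k} β → a < k → IncreasingFrom w k β → length β ℕ.≤ lis w′ k
  lis≤lis′ []          _   _  = z≤n
  lis≤lis′ (_ ∷ [])    _   _  = lis-positive w′
  lis≤lis′ (_ ∷ s ∷ β) a<k β↗ = let _ , k↗s , β′↗ = uncons-increasing w β↗ in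
    ℕ.≤-trans (s≤s (lis≤lis′ (s ∷ β) (Fin.<-trans a<k (proj₁ k↗s)) β′↗))
      (lis-ascent w′ (ascent⇒ascent′ a<k k↗s))

  -- An ascent of `w′` from `b` may be new, but it leads past `b` to a value above that of `w` at
  -- `a`, where `lexLast-later` bounds the length. So lengths carry over from `w′` to `w` even where
  -- subsequences do not.
  lis-ascent′ : ∀ {k r} → a < k → Ascent w′ k r → suc (lis w r) ℕ.≤ lis w k
  lis-ascent′ {k} a<k k↗r with k ≟ b
  ... | yes refl = lexLast-later w last (proj₁ k↗r) (ascent′-b k↗r)
  ... | no k≢b   = lis-ascent w (ascent′⇒ascent a<k k≢b k↗r)

  lis′≤lis : ∀ {k} β → a < k → IncreasingFrom w′ k β → length β ℕ.≤ lis w k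
  lis′≤lis []          _   _  = z≤n
  lis′≤lis (_ ∷ [])    _   _  = lis-positive w
  lis′≤lis (_ ∷ s ∷ β) a<k β↗ = let _ , k↗s , β′↗ = uncons-increasing w′ β↗ in
    ℕ.≤-trans (s≤s (lis′≤lis (s ∷ β) (Fin.<-trans a<k (proj₁ k↗s)) β′↗)) (lis-ascent′ a<k k↗s)

  lis-after : ∀ {k} → a < k → lis w′ k ≡ lis w k
  lis-after a<k = ℕ.≤-antisym (lis-least w′ (λ β → lis′≤lis β a<k))
                              (lis-least w (λ β → lis≤lis′ β a<k))

  lis-unchanged : ∀ {k} → k ≢ a → lis w′ k ≡ lis w k
  lis-unchanged {k} k≢a with Fin.<-cmp k a
  ... | tri> _ _ a<k = lis-after a<k
  ... | tri≈ _ k≡a _ = ⊥-elim (k≢a k≡a)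
  ... | tri< k<a _ _ = trans
    (lis-before-defect w′ λ _ j≤k → w′-before (ℕ.≤-<-trans j≤k k<a))
    (sym (lis-before-defect w λ j j≤k → proj₂ defect j (ℕ.≤-<-trans j≤k k<a)))

  lis-unchanged-everywhere : lis w a ≡ lis w′ a → ∀ k → lis w′ k ≡ lis w k
  lis-unchanged-everywhere kept k = [ (λ { refl → sym kept }) , lis-unchanged ]′ (toSum (k ≟ a))

  lis′-a≤lis-a : lis w′ a ℕ.≤ lis w a
  lis′-a≤lis-a = lis-rec-≤ w′ (lis-positive w) λ r a↗′r →
    subst (λ m → suc m ℕ.≤ lis w a) (sym (lis-after (proj₁ a↗′r)))
      (lis-ascent w (proj₁ a↗′r , Fin.<-trans wa<wb (proj₂ (ascent′-a a↗′r))))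

  ascent-b⇒ascent′-a : ∀ {r} → Ascent w b r → Ascent w′ a r
  ascent-b⇒ascent′-a (b<r , wb<wr) = Fin.<-trans a<b b<r ,
    subst₂ _<_ (sym w′a)
      (sym (w′-other (Fin.<-trans a<b b<r) (λ r≡b → Fin.<⇒≢ b<r (sym r≡b)))) wb<wr

  -- At `a`, `w′` carries the value that `w` has at `b`, and positions after `b` are untouched, so
  -- ascents of `w` from `b` become ascents of `w′` from `a`.
  lis-b≤lis′-a : lis w b ℕ.≤ lis w′ a
  lis-b≤lis′-a = lis-rec-≤ w (lis-positive w′) λ r b↗r →
    subst (λ m → suc m ℕ.≤ lis w′ a) (lis-after (Fin.<-trans a<b (proj₁ b↗r)))
      (lis-ascent w′ (ascent-b⇒ascent′-a b↗r))

  -- Since `lis w a` is one more than `lis w b`, a drop by one means that `lis w′ a` equals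
  -- `lis w b`; only this inequality remains to be checked case by case.
  lis-drops : lis w′ a ℕ.≤ lis w b → lis w a ≡ suc (lis w′ a)
  lis-drops ≤b = trans (lexLast-lis w last) (cong suc (ℕ.≤-antisym lis-b≤lis′-a ≤b))

  -- Covers a next link starting beyond `a`, or no next link: `a` then joins the prefix agreeing
  -- with `w₀`, where lengths are 1.
  lis-drops-fixed : w′ ⟨$⟩ʳ a ≡ opposite a → lis w a ≡ suc (lis w′ a)
  lis-drops-fixed w′a≡ = lis-drops
    (subst (ℕ._≤ lis w b) (sym (lis-before-defect w′ before)) (lis-positive w))
    where
    before : ∀ j → j ≤ a → w′ ⟨$⟩ʳ j ≡ opposite j
    before j j≤a with Fin.<-cmp j a
    ... | tri< j<a _ _  = w′-before j<a
    ... | tri≈ _ refl _ = w′a≡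
    ... | tri> _ _ a<j  = ⊥-elim (ℕ.<⇒≱ a<j j≤a)

  module _ {b′ α′} (last′ : LexLastLIS w′ a (a ∷ b′ ∷ α′)) where

    private
      a↗b′ : Ascent w′ a b′
      a↗b′ = lexLast-ascent w′ last′

    -- By `ascent′-a`, `w` ascends from `b` to `b′`; this step replaces the one from `a` to `b′` in
    -- `w′` at equal length.
    lis-drops-right : b < b′ → lis w a ≡ suc (lis w′ a)
    lis-drops-right b<b′ = lis-drops (subst (ℕ._≤ lis w b)
      (sym (trans (lexLast-lis w′ last′) (cong suc (lis-after (proj₁ a↗b′)))))
      (lis-ascent w (b<b′ , proj₂ (ascent′-a a↗b′))))

    -- Were the length at a to drop, the rest of the subsequence (a, b, …) would
    -- be a longest one from a in w′ that is lexicographically later than (a, b′, …).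
    lis-kept-left : ¬ b < b′ → lis w a ≡ lis w′ a
    lis-kept-left b≮b′ = ℕ.≤-antisym
      (subst₂ ℕ._≤_ (sym (lexLast-lis w last)) (sym (lexLast-lis w′ last′))
        (s≤s (lis-rec-≤ w (lis-positive w′) λ r b↗r →
          subst (λ m → suc m ℕ.≤ lis w′ b′) (lis-after (Fin.<-trans a<b (proj₁ b↗r)))
            (lexLast-later w′ last′ (ℕ.≤-<-trans (ℕ.≮⇒≥ b≮b′) (proj₁ b↗r))
              (ascent-b⇒ascent′-a b↗r)))))
      lis′-a≤lis-a

-- Counting marked links.

linksFrom : Fin n → List (Link n) → ℕ
linksFrom k C = length (filter (λ l → proj₁ l ≟ k) C)

linksFrom-same : ∀ a b (C : List (Link n)) → linksFrom a ((a , b) ∷ C) ≡ suc (linksFrom a C)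
linksFrom-same a b C = cong length (filter-accept (λ l → proj₁ l ≟ a) refl)

linksFrom-other : ∀ a b {k} (C : List (Link n)) → k ≢ a → linksFrom k ((a , b) ∷ C) ≡ linksFrom k C
linksFrom-other a b {k} C k≢a =
  cong length (filter-reject (λ l → proj₁ l ≟ k) (λ a≡k → k≢a (sym a≡k)))

-- For an unmarked second link: the markings of the chain are then those of its tail, with the
-- tail's always marked head `(a , b′)` exchanged for `(a , b)`.
linksFrom-cong : ∀ a b b′ k (C : List (Link n)) →
                 linksFrom k ((a , b) ∷ C) ≡ linksFrom k ((a , b′) ∷ C)
linksFrom-cong a b b′ k C with k ≟ a
... | yes refl = trans (linksFrom-same a b C) (sym (linksFrom-same a b′ C))
... | no k≢a   = trans (linksFrom-other a b C k≢a) (sym (linksFrom-other a b′ C k≢a))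

module _ (w : Perm n) {a b : Fin n} {α : List (Fin n)} (C : List (Link n))
         (defect : FirstDefect w a) (last : LexLastLIS w a (a ∷ b ∷ α)) where
  open NestedStep w defect last

  -- `C` stands for the markings of the tail, all of which survive when the tail is empty or its
  -- head is marked; only the count at `a` grows.
  lis-step : (∀ k → suc (linksFrom k C) ≡ lis w′ k) → lis w a ≡ suc (lis w′ a) →
             ∀ k → suc (linksFrom k ((a , b) ∷ C)) ≡ lis w k
  lis-step ih drop k with k ≟ a
  ... | yes refl = trans (cong suc (linksFrom-same a b C)) (trans (cong suc (ih a)) (sym drop))
  ... | no k≢a   = trans (cong suc (linksFrom-other a b C k≢a)) (trans (ih k) (lis-unchanged k≢a))

linksFrom-minimalMarkings : {w : Perm n} {C : List (Link n)} → IsNestedChain w C →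
                            ∀ k → suc (linksFrom k (minimalMarkings C)) ≡ lis w k
linksFrom-minimalMarkings {w = w} ([] w≈w₀) k = sym (lis-before-defect w λ j _ → w≈w₀ j)
linksFrom-minimalMarkings {w = w} (_∷_ {a = a} {b} (_ , _ , defect , last) chain) k
  with refl , _ ← nested-start w last | chain
... | [] w′≈w₀ = lis-step w [] defect last
  (linksFrom-minimalMarkings chain)
  (NestedStep.lis-drops-fixed w defect last (w′≈w₀ a)) k
... | _∷_ {a = a′} {b′} {C′} isNested@(_ , _ , (_ , before) , last′) _
  with refl , _ ← nested-start (w ·⟨ a , b ⟩) last′ | minimallyMarked? (a , b) (a′ , b′)
...   | yes (inj₁ a<a′) = lis-step w _ defect last (linksFrom-minimalMarkings chain)
  (NestedStep.lis-drops-fixed w defect last (before a a<a′)) k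
...   | yes (inj₂ (refl , b<b′)) = lis-step w _ defect last (linksFrom-minimalMarkings chain)
  (NestedStep.lis-drops-right w defect last last′ b<b′) k
...   | no unmarked with Fin.<-cmp a a′
...     | tri< a<a′ _ _ = ⊥-elim (unmarked (inj₁ a<a′))
...     | tri> _ _ a′<a = ⊥-elim (ℕ.<⇒≱ a′<a (nested-≤-next w (_ , _ , defect , last) isNested))
-- The second link is unmarked, so neither the counts nor the lengths change.
...     | tri≈ _ refl _ = trans
  (trans (cong suc (linksFrom-cong a b b′ k (markedAfter (a , b′) C′))) (linksFrom-minimalMarkings chain k))
  (NestedStep.lis-unchanged-everywhere w defect last
    (NestedStep.lis-kept-left w defect last last′ λ b<b′ → unmarked (inj₂ (refl , b<b′))) k)

theorem6p6 : (n : ℕ) (w : Perm n) → dualWt (ξ w) ≡ rajcode w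
theorem6p6 n w = tabulate-cong λ k →
  -- `+ suc m - 1ℤ` computes to `+ m`, so the left side is already the entry of the dual weight.
  cong (λ m → + m - 1ℤ) (linksFrom-minimalMarkings (proj₂ (nestedChain w)) k)
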